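{- Let $p$ be an odd prime, $f(x)\in\mathbb{Z}[x]$, $n\ge1$, and let $\sigma$ be a cycle of $f_n$ of length $k$ which splits. Let $A=\mathrm{ord}_p(a_n-1)$ and $B=\mathrm{ord}_p(b_n)$ (so $A,B\ge1$). (1) If $B<A$ and $B<n$, then every lift of $\sigma$ splits $B-1$ times, and then grows. (2) If $A\le B$ and $A<n$, then every lift of $\sigma$, except for one, splits $A-1$ times, and then grows; the single exceptional lift behaves in precisely the same way as $\sigma$. That is, there is an infinite sequence $\sigma=\sigma_n,\sigma_{n+1},\sigma_{n+2},\dots$ in which each $\sigma_{j}$ ($j\ge n$) is a cycle of $f_j$ which splits, $\sigma_{j+1}$ is a lift of $\sigma_j$, and every lift of $\sigma_j$ other than $\sigma_{j+1}$ splits $A-1$ times and then grows. (3) If $A\ge n$ and $B\ge n$, then every lift of $\sigma$ splits $n-1$ times.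
   Context: $f_n:\mathbb{Z}/p^n\mathbb{Z}\to\mathbb{Z}/p^n\mathbb{Z}$ is the map $x\mapsto f(x)\bmod p^n$; a cycle of $f_n$ is said to be at level $n$. Let $\sigma=(x_1,\dots,x_k)$ be a cycle of $f_n$ of length $k$ (distinct elements, $f_n(x_i)=x_{i+1}$, $f_n(x_k)=x_1$), with the $x_i$ viewed as integers representing their classes. Put $g=f^k$ ($k$-th iterate), $a_n=g'(x_1)$, $b_n=(g(x_1)-x_1)/p^n$. A lift of $\sigma$ is a cycle of $f_{n+1}$ all of whose elements reduce mod $p^n$ to elements of $\sigma$. The cycle $\sigma$: grows if $a_n\equiv1$ and $b_n\not\equiv0\pmod p$ (then it has a single lift, of length $pk$); splits if $a_n\equiv1$ and $b_n\equiv0\pmod p$ (then it has $p$ lifts, each of length $k$). These conditions are independent of the choices. The same terms apply at every level. The descendants of a cycle $\tau$ at level $N$ are $\tau$ itself (at level $N$), its lifts (at level $N+1$), the lifts of those (at level $N+2$), and so on. A cycle $\tau$ at level $N$ "splits $s$ times" if all its descendants at levels $N,N+1,\dots,N+s-1$ split (no condition if $s=0$); it "splits $s$ times and then grows" if in addition all its descendants at level $N+s$ grow. $\mathrm{ord}_p$ is the $p$-adic valuation, with $\mathrm{ord}_p(0)=\infty$. -}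

module Defs where

open import Data.Fin.Base using (Fin; zero; suc; inject₁; fromℕ)
open import Data.Integer.Base using (ℤ; +_; 0ℤ; 1ℤ; _+_; _*_; _-_; _/ℕ_)
open import Data.Integer.Divisibility.Signed using (_∣_)
open import Data.List.Base using (List; []; _∷_; map)
open import Data.Nat.Base as ℕ using (ℕ; zero; suc; _^_; NonZero)
open import Data.Nat.Properties using (m^n≢0)
open import Data.Product.Base using (_×_; ∃-syntax)
open import Relation.Binary.PropositionalEquality.Core using (_≡_; _≢_)
open import Relation.Nullary.Construct.Add.Supremum using (_⁺; ⊤⁺; [_])
open import Relation.Nullary.Negation.Core using (¬_)

open import Relation.Binary.Construct.Add.Supremum.NonStrict ℕ._≤_ public
  using (_≤⁺_)
open import Relation.Binary.Construct.Add.Supremum.Strict ℕ._<_ public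
  using (_<⁺_)

-- Coefficients in order of increasing degree; trailing zeros are allowed.
Poly : Set
Poly = List ℤ

infixl 6 _⊕_
infixl 7 _⊗_
infixr 9 _⊚_

eval : Poly → ℤ → ℤ
eval []       x = 0ℤ
eval (c ∷ cs) x = c + x * eval cs x

_⊕_ : Poly → Poly → Poly
[]       ⊕ q        = q
(c ∷ cs) ⊕ []       = c ∷ cs
(c ∷ cs) ⊕ (d ∷ ds) = (c + d) ∷ (cs ⊕ ds)

_⊗_ : Poly → Poly → Poly
[]       ⊗ q = []
(c ∷ cs) ⊗ q = map (c *_) q ⊕ (0ℤ ∷ cs ⊗ q)

-- (f ⊚ g)(x) = f(g(x)).
_⊚_ : Poly → Poly → Poly
[]       ⊚ q = []
(c ∷ cs) ⊚ q = (c ∷ []) ⊕ q ⊗ (cs ⊚ q)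

iterate : Poly → ℕ → Poly
iterate f zero    = 0ℤ ∷ 1ℤ ∷ []
iterate f (suc k) = f ⊚ iterate f k

-- Formal derivative: the coefficient of xⁱ is multiplied by i and shifted down.
derivFrom : ℕ → List ℤ → Poly
derivFrom i []       = []
derivFrom i (c ∷ cs) = + i * c ∷ derivFrom (suc i) cs

deriv : Poly → Poly
deriv []       = []
deriv (_ ∷ cs) = derivFrom 1 cs

infix 4 _≡_[mod_] _≢_[mod_]

_≡_[mod_] : ℤ → ℤ → ℕ → Set
x ≡ y [mod m ] = + m ∣ x - y

_≢_[mod_] : ℤ → ℤ → ℕ → Set
x ≢ y [mod m ] = ¬ (x ≡ y [mod m ])

-- Ord p z v is the graph of the p-adic valuation: ord_p(z) = v in ℕ ∪ {∞}.
data Ord (p : ℕ) (z : ℤ) : ℕ ⁺ → Set where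
  infinite : z ≡ 0ℤ → Ord p z ⊤⁺
  finite   : ∀ {v} → + (p ^ v) ∣ z → ¬ (+ (p ^ suc v) ∣ z) → Ord p z [ v ]

-- ℤ/pⁿℤ is the setoid of integers modulo pⁿ, and f_n is the map induced on it
-- by eval f. A value of Cycle p f n is a cycle (x₁,…,x_k) of f_n together with
-- a choice of first element and of integer representatives; two values
-- describe the same cycle exactly when they are related by _≈_ below.
record Cycle (p : ℕ) (f : Poly) (n : ℕ) : Set where
  field
    length-1 : ℕ

  length : ℕ
  length = suc length-1

  field
    elem     : Fin length → ℤ
    distinct : ∀ {i j} → elem i ≡ elem j [mod p ^ n ] → i ≡ j
    step     : ∀ (i : Fin length-1) →
               eval f (elem (inject₁ i)) ≡ elem (suc i) [mod p ^ n ]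
    close    : eval f (elem (fromℕ length-1)) ≡ elem zero [mod p ^ n ]

open Cycle public

module _ {p : ℕ} {f : Poly} {n : ℕ} where

  infix 4 _≈_ _≉_

  -- Equality of cycles: they run through the same residue classes mod pⁿ.
  _≈_ : Cycle p f n → Cycle p f n → Set
  σ ≈ τ = (∀ i → ∃[ j ] elem σ i ≡ elem τ j [mod p ^ n ])
        × (∀ j → ∃[ i ] elem σ i ≡ elem τ j [mod p ^ n ])

  _≉_ : Cycle p f n → Cycle p f n → Set
  σ ≉ τ = ¬ (σ ≈ τ)

  IsLift : Cycle p f n → Cycle p f (suc n) → Set
  IsLift σ τ = ∀ i → ∃[ j ] elem τ i ≡ elem σ j [mod p ^ n ]

  return : Cycle p f n → Poly
  return σ = iterate f (length σ)

  aₙ : Cycle p f n → ℤ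
  aₙ σ = eval (deriv (return σ)) (elem σ zero)

  -- The division is exact, because x₁ is fixed by f_n^k.
  bₙ : .{{_ : NonZero p}} → Cycle p f n → ℤ
  bₙ σ = (eval (return σ) (elem σ zero) - elem σ zero) /ℕ (p ^ n)
    where instance _ = m^n≢0 p n

  Grows : .{{_ : NonZero p}} → Cycle p f n → Set
  Grows σ = aₙ σ ≡ 1ℤ [mod p ] × bₙ σ ≢ 0ℤ [mod p ]

  Splits : .{{_ : NonZero p}} → Cycle p f n → Set
  Splits σ = aₙ σ ≡ 1ℤ [mod p ] × bₙ σ ≡ 0ℤ [mod p ]

-- Descendant τ i ρ: ρ is a descendant of τ, i levels above the level of τ.
data Descendant {p f N} (τ : Cycle p f N) : (i : ℕ) → Cycle p f (i ℕ.+ N) → Set where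
  self : Descendant τ zero τ
  lift : ∀ {i ρ ρ′} → Descendant τ i ρ → IsLift ρ ρ′ → Descendant τ (suc i) ρ′

module _ {p : ℕ} .{{_ : NonZero p}} {f : Poly} {N : ℕ} where

  SplitsTimes : ℕ → Cycle p f N → Set
  SplitsTimes s τ = ∀ i → i ℕ.< s → ∀ ρ → Descendant τ i ρ → Splits ρ

  SplitsTimesThenGrows : ℕ → Cycle p f N → Set
  SplitsTimesThenGrows s τ = SplitsTimes s τ × (∀ ρ → Descendant τ s ρ → Grows ρ)

{-# OPTIONS --safe #-}
-- Put a(x) = (f^k)′(x) and b(x) = (f^k(x) − x)/p^N. By Taylor's formula, replacing
-- x by x + p^N t changes p^N b(x) into p^N (b(x) + t (a(x) − 1)) modulo p^{2N} and
-- leaves a(x) unchanged modulo p^N, while replacing x by f(x) preserves the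
-- conditions p^e ∣ f^k(x) − x and p^d ∣ a(x) − 1. Hence these two conditions pass
-- between a splitting cycle and its lifts when d ≤ N and e ≤ d + N; since lifting
-- turns N + s into (N + 1) + (s − 1), a cycle loses one power of p in b per level
-- until it grows. If ord (a − 1) = A ≤ ord b, exactly one t modulo p makes
-- b + t (a − 1) divisible by p^{A+1}, and it gives the exceptional lift.
module Submission where

open import Defs
open import Data.Fin.Base using (Fin; zero; suc; toℕ; fromℕ; fromℕ<; inject₁)
open import Data.Fin.Induction using (<-weakInduction)
import Data.Fin.Properties as Fin
open import Data.Fin.Relation.Unary.Top using (view; ‵fromℕ; ‵inject₁)
open import Data.Integer.Base
  using (ℤ; +_; -_; 0ℤ; 1ℤ; ∣_∣; _+_; _*_; _-_; _/ℕ_; _%ℕ_)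
open import Data.Integer.Divisibility.Signed
open import Data.Integer.DivMod using (a≡a%ℕn+[a/ℕn]*n; n%ℕd<d)
import Data.Integer.Properties as ℤ
open import Data.Integer.Tactic.RingSolver using (solve-∀)
open import Data.List.Base using ([]; _∷_; map)
open import Data.Nat.Base as ℕ
  using (ℕ; zero; suc; s≤s; z≤n; _∸_; _^_; _≤_; _<_; NonZero)
import Data.Nat.Coprimality as ℕ
open import Data.Nat.Divisibility as ℕ using (_∤_)
import Data.Nat.GCD as ℕ
open import Data.Nat.Primality using (Prime; euclidsLemma; prime⇒irreducible)
import Data.Nat.Properties as ℕ
open import Data.Product.Base using (_×_; _,_; proj₁; proj₂; ∃-syntax; Σ-syntax)
open import Data.Sum.Base using (inj₁; inj₂; [_,_]′)
open import Function.Base using (_∘_)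
open import Relation.Binary.Construct.Add.Supremum.NonStrict ℕ._≤_
  using () renaming ([_] to ≤-[_]; _≤⊤⁺ to ≤-⊤⁺)
open import Relation.Binary.Construct.Add.Supremum.Strict ℕ._<_
  using () renaming ([_] to <-[_]; [_]<⊤⁺ to <-⊤⁺)
open import Relation.Binary.Definitions using (tri<; tri≈; tri>)
open import Relation.Binary.PropositionalEquality
open import Relation.Nullary.Construct.Add.Supremum using (_⁺; [_])
open import Relation.Nullary.Negation.Core using (¬_; contradiction)

-- Congruences as divisibility of differences.

∣-difference-refl : ∀ {d} x → d ∣ x - x
∣-difference-refl x = divides 0ℤ (ℤ.+-inverseʳ x)

∣-difference-sym : ∀ {d} x y → d ∣ x - y → d ∣ y - x
∣-difference-sym x y d = subst (_ ∣_) (identity x y) (∣m⇒∣-m d)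
  where
  identity : ∀ x y → - (x - y) ≡ y - x
  identity = solve-∀

∣-difference-trans : ∀ {d} x y z → d ∣ x - y → d ∣ y - z → d ∣ x - z
∣-difference-trans x y z d e = subst (_ ∣_) (identity x y z) (∣m∣n⇒∣m+n d e)
  where
  identity : ∀ x y z → (x - y) + (y - z) ≡ x - z
  identity = solve-∀

∣-difference-* : ∀ {d} x y u v → d ∣ x - y → d ∣ u - v → d ∣ x * u - y * v
∣-difference-* x y u v d e =
  subst (_ ∣_) (identity x y u v) (∣m∣n⇒∣m+n (∣m⇒∣m*n u d) (∣n⇒∣m*n y e))
  where
  identity : ∀ x y u v → (x - y) * u + y * (u - v) ≡ x * u - y * v
  identity = solve-∀

∣-difference-resp : ∀ {d} x y z → d ∣ x - y → d ∣ x - z → d ∣ y - z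
∣-difference-resp x y z d = ∣-difference-trans y x z (∣-difference-sym x y d)

*-mono-∣ : ∀ {a b c d} → a ∣ b → c ∣ d → a * c ∣ b * d
*-mono-∣ {b = b} {c} a∣b c∣d = ∣-trans (*-monoˡ-∣ c a∣b) (*-monoʳ-∣ b c∣d)

-- Evaluation of polynomial operations.

eval-⊕ : ∀ f g x → eval (f ⊕ g) x ≡ eval f x + eval g x
eval-⊕ []       g        x = sym (ℤ.+-identityˡ (eval g x))
eval-⊕ (c ∷ cs) []       x = sym (ℤ.+-identityʳ (eval (c ∷ cs) x))
eval-⊕ (c ∷ cs) (d ∷ ds) x
  rewrite eval-⊕ cs ds x = identity c d x (eval cs x) (eval ds x)
  where
  identity : ∀ c d x u v → c + d + x * (u + v) ≡ c + x * u + (d + x * v)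
  identity = solve-∀

eval-map-* : ∀ c f x → eval (map (c *_) f) x ≡ c * eval f x
eval-map-* c []       x = sym (ℤ.*-zeroʳ c)
eval-map-* c (d ∷ ds) x
  rewrite eval-map-* c ds x = identity c d x (eval ds x)
  where
  identity : ∀ c d x u → c * d + x * (c * u) ≡ c * (d + x * u)
  identity = solve-∀

eval-⊗ : ∀ f g x → eval (f ⊗ g) x ≡ eval f x * eval g x
eval-⊗ []       g x = sym (ℤ.*-zeroˡ (eval g x))
eval-⊗ (c ∷ cs) g x
  rewrite eval-⊕ (map (c *_) g) (0ℤ ∷ cs ⊗ g) x
        | eval-map-* c g x
        | eval-⊗ cs g x = identity c x (eval cs x) (eval g x)
  where
  identity : ∀ c x u v → c * v + (0ℤ + x * (u * v)) ≡ (c + x * u) * v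
  identity = solve-∀

eval-⊚ : ∀ f g x → eval (f ⊚ g) x ≡ eval f (eval g x)
eval-⊚ []       g x = refl
eval-⊚ (c ∷ cs) g x
  rewrite eval-⊕ (c ∷ []) (g ⊗ (cs ⊚ g)) x
        | eval-⊗ g (cs ⊚ g) x
        | eval-⊚ cs g x
        | ℤ.*-zeroʳ x
        | ℤ.+-identityʳ c = refl

eval-cong : ∀ {d} f x y → d ∣ x - y → d ∣ eval f x - eval f y
eval-cong []       x y d = ∣-difference-refl 0ℤ
eval-cong (c ∷ cs) x y d =
  subst (_ ∣_) (identity c (x * eval cs x) (y * eval cs y))
    (∣-difference-* x y (eval cs x) (eval cs y) d (eval-cong cs x y d))
  where
  identity : ∀ c u v → u - v ≡ c + u - (c + v)
  identity = solve-∀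

-- Formal derivatives and first-order Taylor expansion.

eval-derivFrom-suc : ∀ i f x →
  eval (derivFrom (suc i) f) x ≡ eval (derivFrom i f) x + eval f x
eval-derivFrom-suc i []       x = refl
eval-derivFrom-suc i (c ∷ cs) x
  rewrite eval-derivFrom-suc (suc i) cs x
        | ℤ.pos-+ 1 i = identity (+ i) c x (eval (derivFrom (suc i) cs) x) (eval cs x)
  where
  identity : ∀ i c x u v → (1ℤ + i) * c + x * (u + v) ≡ i * c + x * u + (c + x * v)
  identity = solve-∀

eval-derivFrom-zero : ∀ f x → eval (derivFrom 0 f) x ≡ x * eval (deriv f) x
eval-derivFrom-zero []       x = sym (ℤ.*-zeroʳ x)
eval-derivFrom-zero (c ∷ cs) x = identity c (x * eval (derivFrom 1 cs) x)
  where
  identity : ∀ c u → 0ℤ * c + u ≡ u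
  identity = solve-∀

-- The product rule for `c + x f`: raising the counter of `derivFrom` by one adds a copy of `f`, and
-- starting it at zero gives `x` times the derivative.
eval-deriv-∷ : ∀ c f x → eval (deriv (c ∷ f)) x ≡ eval f x + x * eval (deriv f) x
eval-deriv-∷ c f x
  rewrite eval-derivFrom-suc 0 f x
        | eval-derivFrom-zero f x = ℤ.+-comm (x * eval (deriv f) x) (eval f x)

-- The Taylor remainder is recorded only through its divisibility by `(y - x)²`, which is enough to
-- discard it modulo `p ^ (N + N)` when `y` and `x` agree modulo `p ^ N`.
HasDerivative : (ℤ → ℤ) → ℤ → ℤ → Set
HasDerivative F x m = ∀ y → (y - x) * (y - x) ∣ F y - F x - (y - x) * m

eval-hasDerivative : ∀ f x → HasDerivative (eval f) x (eval (deriv f) x)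
eval-hasDerivative []       x y = divides 0ℤ (identity y x)
  where
  identity : ∀ y x → 0ℤ - 0ℤ - (y - x) * 0ℤ ≡ 0ℤ * ((y - x) * (y - x))
  identity = solve-∀
eval-hasDerivative (c ∷ cs) x y
  rewrite eval-deriv-∷ c cs x =
  subst (_ ∣_) (identity c x y (eval cs x) (eval cs y) (eval (deriv cs) x))
    (∣m∣n⇒∣m+n (∣n⇒∣m*n x (eval-hasDerivative cs x y))
               (*-monoʳ-∣ (y - x) (eval-cong cs y x ∣-refl)))
  where
  identity : ∀ c x y u v m →
    x * (v - u - (y - x) * m) + (y - x) * (v - u)
      ≡ c + y * v - (c + x * u) - (y - x) * (u + x * m)
  identity = solve-∀

∣-difference⇒≡ : ∀ a b → + suc ∣ a - b ∣ ∣ a - b → a ≡ b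
∣-difference⇒≡ a b d = ℤ.i-j≡0⇒i≡j a b (ℤ.∣i∣≡0⇒i≡0 (vanish (∣⇒∣ᵤ d)))
  where
  vanish : ∀ {m} → suc m ℕ.∣ m → m ≡ 0
  vanish {zero}  _ = refl
  vanish {suc m} d = contradiction (ℕ.∣⇒≤ d) ℕ.1+n≰n

-- Subtracting the two expansions at `x + h` shows that `h * h` divides `h * (a - b)`. Choosing `h`
-- larger than `∣ a - b ∣` forces the difference to vanish.
derivative-unique : ∀ {F x a b} → HasDerivative F x a → HasDerivative F x b → a ≡ b
derivative-unique {F} {x} {a} {b} Da Db = ∣-difference⇒≡ a b
  (*-cancelˡ-∣ h (subst₂ _∣_ (square h x) (difference (F (x + h)) (F x) h x a b)
    (∣m∣n⇒∣m-n (Db (x + h)) (Da (x + h)))))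
  where
  h = + suc ∣ a - b ∣
  square : ∀ h x → (x + h - x) * (x + h - x) ≡ h * h
  square = solve-∀
  difference : ∀ u v h x a b →
    u - v - (x + h - x) * b - (u - v - (x + h - x) * a) ≡ h * (a - b)
  difference = solve-∀

-- Prime powers, inverses modulo a prime, exact division.

^-monoʳ-∣ : ∀ p {m n} → m ≤ n → + (p ^ m) ∣ + (p ^ n)
^-monoʳ-∣ p {m} {n} m≤n = ∣ᵤ⇒∣ (ℕ.divides (p ^ (n ∸ m))
  (trans (cong (p ^_) (sym (ℕ.m∸n+n≡m m≤n))) (ℕ.^-distribˡ-+-* p (n ∸ m) m)))

^-∣-weaken : ∀ p {m n z} → m ≤ n → + (p ^ n) ∣ z → + (p ^ m) ∣ z
^-∣-weaken p m≤n = ∣-trans (^-monoʳ-∣ p m≤n)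

pos-^-+ : ∀ p m n → + (p ^ (m ℕ.+ n)) ≡ + (p ^ m) * + (p ^ n)
pos-^-+ p m n = trans (cong +_ (ℕ.^-distribˡ-+-* p m n)) (ℤ.pos-* (p ^ m) (p ^ n))

^-∣-* : ∀ p m n {l u v} → l ≤ m ℕ.+ n →
  + (p ^ m) ∣ u → + (p ^ n) ∣ v → + (p ^ l) ∣ u * v
^-∣-* p m n l≤m+n d e =
  ^-∣-weaken p l≤m+n (subst (_∣ _) (sym (pos-^-+ p m n)) (*-mono-∣ d e))

module _ {p : ℕ} (p-prime : Prime p) where

  private
    p-coprime : ∀ {u} → ¬ + p ∣ u → ℕ.Coprime p ∣ u ∣
    p-coprime p∤u (d∣p , d∣u) with prime⇒irreducible p-prime d∣p
    ... | inj₁ d≡1  = d≡1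
    ... | inj₂ refl = contradiction (∣ᵤ⇒∣ d∣u) p∤u

    inverse-abs : ∀ {u} → ¬ + p ∣ u → ∃[ w ] + p ∣ w * + ∣ u ∣ - 1ℤ
    inverse-abs {u} p∤u with ℕ.coprime-Bézout (p-coprime p∤u)
    -- Here Bézout reads `1 + y * ∣ u ∣ ≡ x * p`, so the inverse carries a minus sign.
    ... | ℕ.Bézout.+- x y eq = - + y , divides (- + x)
      (trans (cong (λ z → - + y * + ∣ u ∣ - z) (sym (identity₁ (+ y * + ∣ u ∣))))
        (trans (cong (λ z → - + y * + ∣ u ∣ - (z - + y * + ∣ u ∣)) lifted)
          (identity₂ (+ x) (+ y) (+ ∣ u ∣) (+ p))))
      where
      lifted : 1ℤ + + y * + ∣ u ∣ ≡ + x * + p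
      lifted = trans (cong (λ z → 1ℤ + z) (sym (ℤ.pos-* y ∣ u ∣)))
        (trans (sym (ℤ.pos-+ 1 (y ℕ.* ∣ u ∣))) (trans (cong +_ eq) (ℤ.pos-* x p)))
      identity₁ : ∀ z → 1ℤ + z - z ≡ 1ℤ
      identity₁ = solve-∀
      identity₂ : ∀ x y u p → - y * u - (x * p - y * u) ≡ - x * p
      identity₂ = solve-∀
    ... | ℕ.Bézout.-+ x y eq = + y , divides (+ x)
      (trans (cong (_- 1ℤ) (sym lifted)) (identity (+ x * + p)))
      where
      lifted : 1ℤ + + x * + p ≡ + y * + ∣ u ∣
      lifted = trans (cong (λ z → 1ℤ + z) (sym (ℤ.pos-* x p)))
        (trans (sym (ℤ.pos-+ 1 (x ℕ.* p))) (trans (cong +_ eq) (ℤ.pos-* y ∣ u ∣)))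
      identity : ∀ z → 1ℤ + z - 1ℤ ≡ z
      identity = solve-∀

  inverse-mod-prime : ∀ {u} → ¬ + p ∣ u → ∃[ w ] + p ∣ w * u - 1ℤ
  inverse-mod-prime {u} p∤u with inverse-abs p∤u | ℤ.+∣i∣≡i⊎+∣i∣≡-i u
  ... | w , d | inj₁ ∣u∣≡u  = w , subst (λ z → + p ∣ w * z - 1ℤ) ∣u∣≡u d
  ... | w , d | inj₂ ∣u∣≡-u = - w ,
    subst (λ z → + p ∣ z - 1ℤ) (trans (cong (w *_) ∣u∣≡-u) (identity w u)) d
    where
    identity : ∀ w u → w * - u ≡ - w * u
    identity = solve-∀

  prime-∣-* : ∀ s u → + p ∣ s * u → ¬ + p ∣ u → + p ∣ s
  prime-∣-* s u d p∤u =
    [ ∣ᵤ⇒∣ , (λ e → contradiction (∣ᵤ⇒∣ e) p∤u) ]′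
      (euclidsLemma ∣ s ∣ ∣ u ∣ p-prime (subst (p ℕ.∣_) (ℤ.abs-* s u) (∣⇒∣ᵤ d)))

∣m-n∣n⇒∣m : ∀ {d} m n → d ∣ m - n → d ∣ n → d ∣ m
∣m-n∣n⇒∣m m n d e = ∣m+n∣n⇒∣m {m = m} d (∣m⇒∣-m e)

∣m-n∣m⇒∣n : ∀ {d} m n → d ∣ m - n → d ∣ m → d ∣ n
∣m-n∣m⇒∣n m n d e = ∣m-n∣n⇒∣m n m (∣-difference-sym m n d) e

/ℕ-exact : ∀ z d .{{_ : NonZero d}} → + d ∣ z → z ≡ (z /ℕ d) * + d
/ℕ-exact z d d∣z = begin
  z                           ≡⟨ a≡a%ℕn+[a/ℕn]*n z d ⟩
  + (z %ℕ d) + z /ℕ d * + d   ≡⟨ cong (λ r → + r + z /ℕ d * + d) (vanish (n%ℕd<d z d) (∣⇒∣ᵤ d∣r)) ⟩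
  0ℤ + z /ℕ d * + d           ≡⟨ ℤ.+-identityˡ _ ⟩
  z /ℕ d * + d                ∎
  where
  open ≡-Reasoning
  vanish : ∀ {r} → r < d → d ℕ.∣ r → r ≡ 0
  vanish {zero}  _   _   = refl
  vanish {suc r} r<d d∣r = contradiction (ℕ.∣⇒≤ d∣r) (ℕ.<⇒≱ r<d)
  d∣r : + d ∣ + (z %ℕ d)
  d∣r = ∣m+n∣n⇒∣m {n = z /ℕ d * + d} (subst (+ d ∣_) (a≡a%ℕn+[a/ℕn]*n z d) d∣z)
          (∣n⇒∣m*n (z /ℕ d) ∣-refl)

-- Iterates and their multipliers.

module Iteration (f : Poly) where

  private
    F F′ : ℤ → ℤ
    F  = eval f
    F′ = eval (deriv f)

  iter : ℕ → ℤ → ℤ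
  iter zero    x = x
  iter (suc k) x = F (iter k x)

  -- The derivative of the `k`-th iterate in chain-rule form, as the product of the values of `F′`
  -- along the orbit.
  multiplier : ℕ → ℤ → ℤ
  multiplier zero    x = 1ℤ
  multiplier (suc k) x = F′ (iter k x) * multiplier k x

  iter-+ : ∀ i j x → iter (i ℕ.+ j) x ≡ iter i (iter j x)
  iter-+ zero    j x = refl
  iter-+ (suc i) j x = cong F (iter-+ i j x)

  iter-comm : ∀ i j x → iter i (iter j x) ≡ iter j (iter i x)
  iter-comm i j x = begin
    iter i (iter j x)  ≡⟨ iter-+ i j x ⟨
    iter (i ℕ.+ j) x   ≡⟨ cong (λ m → iter m x) (ℕ.+-comm i j) ⟩
    iter (j ℕ.+ i) x   ≡⟨ iter-+ j i x ⟩
    iter j (iter i x)  ∎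
    where open ≡-Reasoning

  iter-cong : ∀ {d} k x y → d ∣ x - y → d ∣ iter k x - iter k y
  iter-cong zero    x y d = d
  iter-cong (suc k) x y d = eval-cong f (iter k x) (iter k y) (iter-cong k x y d)

  multiplier-cong : ∀ {d} k x y → d ∣ x - y → d ∣ multiplier k x - multiplier k y
  multiplier-cong zero    x y d = ∣-difference-refl 1ℤ
  multiplier-cong (suc k) x y d =
    ∣-difference-* (F′ (iter k x)) (F′ (iter k y)) (multiplier k x) (multiplier k y)
      (eval-cong (deriv f) (iter k x) (iter k y) (iter-cong k x y d)) (multiplier-cong k x y d)

  -- The chain rule. The remainder of `F` between `X` and `Y` is divisible by `(Y - X)²`, hence by
  -- `(y - x)²` because iterates preserve congruences; the remainder of the previous iterate is only
  -- scaled by `F′ X`.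
  iter-hasDerivative : ∀ k x → HasDerivative (iter k) x (multiplier k x)
  iter-hasDerivative zero    x y = divides 0ℤ (identity y x)
    where
    identity : ∀ y x → y - x - (y - x) * 1ℤ ≡ 0ℤ * ((y - x) * (y - x))
    identity = solve-∀
  iter-hasDerivative (suc k) x y =
    subst (_ ∣_) (identity (F Y) (F X) (y - x) Y X (F′ X) (multiplier k x))
      (∣m∣n⇒∣m+n
        (∣-trans (*-mono-∣ (iter-cong k y x ∣-refl) (iter-cong k y x ∣-refl))
          (eval-hasDerivative f X Y))
        (∣n⇒∣m*n (F′ X) (iter-hasDerivative k x y)))
    where
    X = iter k x
    Y = iter k y
    identity : ∀ u v e Y X a m →
      u - v - (Y - X) * a + a * (Y - X - e * m) ≡ u - v - e * (a * m)
    identity = solve-∀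

  eval-iterate : ∀ k x → eval (iterate f k) x ≡ iter k x
  eval-iterate zero    x = identity x
    where
    identity : ∀ x → 0ℤ + x * (1ℤ + x * 0ℤ) ≡ x
    identity = solve-∀
  eval-iterate (suc k) x =
    trans (eval-⊚ f (iterate f k) x) (cong F (eval-iterate k x))

  -- Both sides are derivatives of the same function in the sense of `HasDerivative`, so uniqueness
  -- takes the place of a chain rule on coefficient lists.
  eval-deriv-iterate : ∀ k x → eval (deriv (iterate f k)) x ≡ multiplier k x
  eval-deriv-iterate k x =
    derivative-unique {iter k} {x} derivative (iter-hasDerivative k x)
    where
    derivative : HasDerivative (iter k) x (eval (deriv (iterate f k)) x)
    derivative y =
      subst₂ (λ u v → (y - x) * (y - x) ∣ u - v - (y - x) * eval (deriv (iterate f k)) x)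
        (eval-iterate k y) (eval-iterate k x)
        (eval-hasDerivative (iterate f k) x y)

  -- The defining recursion splits off the last orbit point; splitting off the first exposes the
  -- overlap between the products started at `x` and at `F x`.
  multiplier-suc : ∀ k x → multiplier (suc k) x ≡ multiplier k (F x) * F′ x
  multiplier-suc zero    x = ℤ.*-comm (F′ x) 1ℤ
  multiplier-suc (suc k) x = begin
    F′ (F (iter k x)) * multiplier (suc k) x
      ≡⟨ cong₂ (λ u v → F′ u * v) (iter-comm 1 k x) (multiplier-suc k x) ⟩
    F′ (iter k (F x)) * (multiplier k (F x) * F′ x)
      ≡⟨ ℤ.*-assoc (F′ (iter k (F x))) (multiplier k (F x)) (F′ x) ⟨
    F′ (iter k (F x)) * multiplier k (F x) * F′ x ∎
    where open ≡-Reasoning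

  -- (f^k)′(f x) and (f^k)′(x) are products over cyclically shifted orbit
  -- segments, differing only in the factors f′(f^k x) and f′(x).
  multiplier-shift : ∀ {d} k x → d ∣ iter k x - x →
    d ∣ multiplier k (F x) - multiplier k x
  multiplier-shift zero    x d = ∣-difference-refl 1ℤ
  multiplier-shift (suc k) x d =
    subst₂ (λ u v → _ ∣ u - v) (ℤ.*-comm (multiplier k (F x)) (F′ (iter k (F x))))
      (sym (multiplier-suc k x))
      (∣-difference-* (multiplier k (F x)) (multiplier k (F x)) (F′ (iter k (F x))) (F′ x)
        (∣-difference-refl (multiplier k (F x)))
        (eval-cong (deriv f) (iter k (F x)) x
          (subst (λ z → _ ∣ z - x) (iter-comm 1 k x) d)))

  -- Displacement and multiplier conditions at a point.

  module _ (p : ℕ) where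

    private
      infix 4 _≋_[_]
      _≋_[_] : ℤ → ℤ → ℕ → Set
      x ≋ y [ N ] = x ≡ y [mod p ^ N ]

    -- The exponent `e` is absolute: at level `N`, `e = v + N` expresses that `p ^ v` divides `b`.
    -- The condition thus keeps its form when a lift raises the level.
    Near : ℕ → ℕ → ℕ → ℤ → Set
    Near k e d x = iter k x ≋ x [ e ] × multiplier k x ≋ 1ℤ [ d ]

    displacement-taylor : ∀ N {l} k x y → l ≤ N ℕ.+ N → y ≋ x [ N ] →
      iter k y - y ≋ (iter k x - x) + (y - x) * (multiplier k x - 1ℤ) [ l ]
    displacement-taylor N k x y l≤N+N y≋x =
      subst (_ ∣_) (identity (iter k y) (iter k x) x y (multiplier k x))
        (∣-trans (^-∣-* p N N l≤N+N y≋x y≋x) (iter-hasDerivative k x y))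
      where
      identity : ∀ u v x y m →
        u - v - (y - x) * m ≡ u - y - ((v - x) + (y - x) * (m - 1ℤ))
      identity = solve-∀

    -- The linear Taylor term `(y - x) * (multiplier k x - 1ℤ)` is divisible by `p ^ (N + d)`, so
    -- `e ≤ d + N` removes it. With `d ≤ N` also `e ≤ N + N`, which removes the remainder.
    Near-resp : ∀ {N e d} k x y → d ≤ N → e ≤ d ℕ.+ N →
      y ≋ x [ N ] → Near k e d x → Near k e d y
    Near-resp {N} {e} {d} k x y d≤N e≤d+N y≋x (a , b) =
      ∣m-n∣n⇒∣m (iter k y - y) _
        (displacement-taylor N k x y (ℕ.≤-trans e≤d+N (ℕ.+-monoˡ-≤ N d≤N)) y≋x)
        (∣m∣n⇒∣m+n a (^-∣-* p N d (subst (e ≤_) (ℕ.+-comm d N) e≤d+N) y≋x b)) ,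
      ∣-difference-trans (multiplier k y) (multiplier k x) 1ℤ
        (multiplier-cong k y x (^-∣-weaken p d≤N y≋x)) b

    -- `F` commutes with its iterates and preserves congruences. For the multiplier, the cyclic
    -- shift needs the orbit to close modulo `p ^ d`, whence `d ≤ e`.
    Near-step : ∀ {e d} k x → d ≤ e → Near k e d x → Near k e d (F x)
    Near-step k x d≤e (a , b) =
      subst (λ z → _ ∣ z - F x) (iter-comm 1 k x) (eval-cong f (iter k x) x a) ,
      ∣-difference-trans (multiplier k (F x)) (multiplier k x) 1ℤ
        (multiplier-shift k x (^-∣-weaken p d≤e a)) b

    Near-iter : ∀ {e d} k j x → d ≤ e → Near k e d x → Near k e d (iter j x)
    Near-iter k zero    x d≤e near = near
    Near-iter k (suc j) x d≤e near = Near-step k (iter j x) d≤e (Near-iter k j x d≤e near)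

    Near-weaken : ∀ {e e′ d d′} k x → e′ ≤ e → d′ ≤ d → Near k e d x → Near k e′ d′ x
    Near-weaken k x e′≤e d′≤d (a , b) = ^-∣-weaken p e′≤e a , ^-∣-weaken p d′≤d b

    module _ .{{_ : NonZero p}} (p-prime : Prime p) where

      -- With f^k x − x = b p^{A+N} and (f^k)′(x) − 1 = u p^A, the displacement
      -- of x + p^N t is (b + t u) p^{A+N} modulo p^{2N}.
      refine : ∀ {N A} k x → A < N → Near k (A ℕ.+ N) A x →
        ¬ multiplier k x ≋ 1ℤ [ suc A ] →
        ∃[ y ] y ≋ x [ N ] × iter k y ≋ y [ suc (A ℕ.+ N) ]
      refine {N} {A} k x A<N (divides b b-eq , divides u u-eq) sharp =
        y , y≋x ,
        ∣m-n∣n⇒∣m (iter k y - y) _ (displacement-taylor N k x y bound y≋x)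
          (subst₂ _∣_ (sym (pos-^-+ p 1 (A ℕ.+ N))) (sym linear)
            (*-monoˡ-∣ (+ (p ^ (A ℕ.+ N))) p∣b+tu))
        where
        p∤u : ¬ + p ∣ u
        p∤u d = sharp (subst₂ _∣_ (sym (ℤ.pos-* p (p ^ A))) (sym u-eq) (*-monoˡ-∣ (+ (p ^ A)) d))
        -- `w` inverts `u` modulo `p`, so `t` solves `b + t * u ≡ 0` modulo `p`.
        w = proj₁ (inverse-mod-prime p-prime p∤u)
        t = - b * w
        y = x + t * + (p ^ N)
        y-x : ∀ x t q → x + t * q - x ≡ t * q
        y-x = solve-∀
        y≋x : + (p ^ N) ∣ y - x
        y≋x = divides t (y-x x t (+ (p ^ N)))
        -- `A < N` is exactly what keeps the target exponent within the Taylor precision `N + N`.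
        bound : suc (A ℕ.+ N) ≤ N ℕ.+ N
        bound = ℕ.+-monoˡ-≤ N A<N
        p^1 : + p ≡ + (p ^ 1)
        p^1 = cong +_ (sym (ℕ.*-identityʳ p))
        solved : ∀ b w u → - b * (w * u - 1ℤ) ≡ b + - b * w * u
        solved = solve-∀
        p∣b+tu : + (p ^ 1) ∣ b + t * u
        p∣b+tu = subst₂ _∣_ p^1 (solved b w u)
          (∣n⇒∣m*n (- b) (proj₂ (inverse-mod-prime p-prime p∤u)))
        factor : ∀ b q r t u → b * (r * q) + t * q * (u * r) ≡ (b + t * u) * (r * q)
        factor = solve-∀
        linear : (iter k x - x) + (y - x) * (multiplier k x - 1ℤ)
                   ≡ (b + t * u) * + (p ^ (A ℕ.+ N))
        linear = trans
          (cong₂ _+_ (trans b-eq (cong (b *_) (pos-^-+ p A N)))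
                     (cong₂ _*_ (y-x x t (+ (p ^ N))) u-eq))
          (trans (factor b (+ (p ^ N)) (+ (p ^ A)) t u)
                 (cong ((b + t * u) *_) (sym (pos-^-+ p A N))))

      -- Write `y - x = s * p ^ N` and `multiplier k x - 1ℤ = u * p ^ A`. Both displacements vanish
      -- modulo `p ^ suc (A + N)`, so the linear term does too; cancelling powers leaves `p`
      -- dividing `s * u`, and `u` is prime to `p`.
      refine-unique : ∀ {N A} k x y → A < N → y ≋ x [ N ] →
        iter k y ≋ y [ suc (A ℕ.+ N) ] →
        Near k (suc (A ℕ.+ N)) A x → ¬ multiplier k x ≋ 1ℤ [ suc A ] →
        y ≋ x [ suc N ]
      refine-unique {N} {A} k x y A<N y≋x@(divides s s-eq) y-fix (x-fix , divides u u-eq) sharp =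
        subst₂ _∣_ (sym (ℤ.pos-* p (p ^ N))) (sym s-eq) (*-monoˡ-∣ (+ (p ^ N)) p∣s)
        where
        p∤u : ¬ + p ∣ u
        p∤u d = sharp (subst₂ _∣_ (sym (ℤ.pos-* p (p ^ A))) (sym u-eq) (*-monoˡ-∣ (+ (p ^ A)) d))
        bound : suc (A ℕ.+ N) ≤ N ℕ.+ N
        bound = ℕ.+-monoˡ-≤ N A<N
        linear : + (p ^ suc (A ℕ.+ N)) ∣ (y - x) * (multiplier k x - 1ℤ)
        linear = ∣m+n∣m⇒∣n
          (∣m-n∣m⇒∣n (iter k y - y) _ (displacement-taylor N k x y bound y≋x) y-fix) x-fix
        factor : ∀ s q u r → s * q * (u * r) ≡ s * u * (r * q)
        factor = solve-∀
        p∣s : + p ∣ s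
        p∣s = prime-∣-* p-prime s u
          (*-cancelʳ-∣ (+ (p ^ (A ℕ.+ N))) {{ℕ.m^n≢0 p (A ℕ.+ N)}}
            (subst₂ _∣_ (ℤ.pos-* p (p ^ (A ℕ.+ N)))
              (trans (cong₂ _*_ s-eq u-eq)
                (trans (factor s (+ (p ^ N)) u (+ (p ^ A)))
                  (cong (s * u *_) (sym (pos-^-+ p A N)))))
              linear)) p∤u

-- Cycles as orbits of their first element.

module _ {p : ℕ} {f : Poly} where

  open Iteration f

  private
    infix 4 _≋_[_]
    _≋_[_] : ℤ → ℤ → ℕ → Set
    x ≋ y [ N ] = x ≡ y [mod p ^ N ]

  module _ {N : ℕ} where

    elem≋iter : (σ : Cycle p f N) → ∀ i → iter (toℕ i) (elem σ zero) ≋ elem σ i [ N ]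
    elem≋iter σ = <-weakInduction _ (∣-difference-refl (elem σ zero)) next
      where
      x = elem σ zero
      next : ∀ i → iter (toℕ (inject₁ i)) x ≋ elem σ (inject₁ i) [ N ] →
             iter (suc (toℕ i)) x ≋ elem σ (suc i) [ N ]
      next i eq rewrite Fin.toℕ-inject₁ i =
        ∣-difference-trans (iter (suc (toℕ i)) x) (eval f (elem σ (inject₁ i))) (elem σ (suc i))
          (eval-cong f (iter (toℕ i) x) (elem σ (inject₁ i)) eq) (step σ i)

    iter-length : (σ : Cycle p f N) → iter (length σ) (elem σ zero) ≋ elem σ zero [ N ]
    iter-length σ =
      ∣-difference-trans (iter (length σ) x) (eval f (elem σ (fromℕ (length-1 σ)))) x
        (eval-cong f (iter (length-1 σ) x) (elem σ (fromℕ (length-1 σ)))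
          (subst (λ m → iter m x ≋ elem σ (fromℕ (length-1 σ)) [ N ])
            (Fin.toℕ-fromℕ (length-1 σ)) (elem≋iter σ (fromℕ (length-1 σ)))))
        (close σ)
      where x = elem σ zero

    iter-visits : (σ : Cycle p f N) → ∀ m → ∃[ j ] iter m (elem σ zero) ≋ elem σ j [ N ]
    iter-visits σ zero = zero , ∣-difference-refl (elem σ zero)
    iter-visits σ (suc m) with iter-visits σ m
    ... | j , eq with view j
    ...   | ‵fromℕ = zero ,
      ∣-difference-trans (eval f (iter m (elem σ zero))) (eval f (elem σ j)) (elem σ zero)
        (eval-cong f (iter m (elem σ zero)) (elem σ j) eq) (close σ)
    ...   | ‵inject₁ i = suc i ,
      ∣-difference-trans (eval f (iter m (elem σ zero))) (eval f (elem σ j)) (elem σ (suc i))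
        (eval-cong f (iter m (elem σ zero)) (elem σ j) eq) (step σ i)

    no-shorter-period : (σ : Cycle p f N) → ∀ {l} → suc l < length σ →
      ¬ iter (suc l) (elem σ zero) ≋ elem σ zero [ N ]
    no-shorter-period σ {l} l<k period =
      contradiction (distinct σ {fromℕ< l<k} {zero} eq) λ ()
      where
      x = elem σ zero
      eq : elem σ (fromℕ< l<k) ≋ x [ N ]
      eq = ∣-difference-resp (iter (suc l) x) (elem σ (fromℕ< l<k)) x
        (subst (λ m → iter m x ≋ elem σ (fromℕ< l<k) [ N ]) (Fin.toℕ-fromℕ< l<k)
          (elem≋iter σ (fromℕ< l<k)))
        period

    -- A lift may start above any element of `σ`. Running the remaining steps around the cycle
    -- returns to its start, which lets conditions on a lift be carried back to `σ`.
    iter-to-start : (σ : Cycle p f N) → ∀ {y} j → y ≋ elem σ j [ N ] →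
      elem σ zero ≋ iter (length σ ∸ toℕ j) y [ N ]
    iter-to-start σ {y} j y≋ =
      ∣-difference-sym (iter m y) x
        (∣-difference-trans (iter m y) (iter m (iter (toℕ j) x)) x
          (iter-cong m y (iter (toℕ j) x)
            (∣-difference-trans y (elem σ j) (iter (toℕ j) x) y≋
              (∣-difference-sym (iter (toℕ j) x) (elem σ j) (elem≋iter σ j))))
          (subst (λ z → z ≋ x [ N ])
            (trans (cong (λ l → iter l x) (sym (ℕ.m∸n+n≡m (ℕ.<⇒≤ (Fin.toℕ<n j)))))
              (iter-+ m (toℕ j) x))
            (iter-length σ)))
      where
      x = elem σ zero
      m = length σ ∸ toℕ j

    -- Each first element is congruent to an iterate of the other, so each cycle runs inside the
    -- forward orbit of the other.
    common-elem⇒≈ : (τ σ : Cycle p f N) → ∀ j → elem τ zero ≋ elem σ j [ N ] → τ ≈ σ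
    common-elem⇒≈ τ σ j y≋ = forth , back
      where
      x = elem σ zero
      y = elem τ zero
      l = length σ ∸ toℕ j
      y≋iter : y ≋ iter (toℕ j) x [ N ]
      y≋iter = ∣-difference-trans y (elem σ j) (iter (toℕ j) x) y≋
        (∣-difference-sym (iter (toℕ j) x) (elem σ j) (elem≋iter σ j))
      forth : ∀ i → ∃[ i′ ] elem τ i ≋ elem σ i′ [ N ]
      forth i with iter-visits σ (toℕ i ℕ.+ toℕ j)
      ... | i′ , eq = i′ ,
        ∣-difference-resp (iter (toℕ i) y) (elem τ i) (elem σ i′) (elem≋iter τ i)
          (∣-difference-trans (iter (toℕ i) y) (iter (toℕ i) (iter (toℕ j) x)) (elem σ i′)
            (iter-cong (toℕ i) y (iter (toℕ j) x) y≋iter)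
            (subst (_≋ elem σ i′ [ N ]) (iter-+ (toℕ i) (toℕ j) x) eq))
      back : ∀ i → ∃[ i′ ] elem τ i′ ≋ elem σ i [ N ]
      back i with iter-visits τ (toℕ i ℕ.+ l)
      ... | i′ , eq = i′ ,
        ∣-difference-resp (iter (toℕ i) (iter l y)) (elem τ i′) (elem σ i)
          (subst (_≋ elem τ i′ [ N ]) (iter-+ (toℕ i) l y) eq)
          (∣-difference-trans (iter (toℕ i) (iter l y)) (iter (toℕ i) x) (elem σ i)
            (iter-cong (toℕ i) (iter l y) x
              (∣-difference-sym x (iter l y) (iter-to-start σ j y≋)))
            (elem≋iter σ i))

  -- Passing between a splitting cycle and its lifts.

  CycleNear : ∀ {N} → ℕ → ℕ → Cycle p f N → Set
  CycleNear e d σ = Near p (length σ) e d (elem σ zero)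

  module _ {N : ℕ} (1≤N : 1 ≤ N) (σ : Cycle p f N) (σ-splits : CycleNear (suc N) 1 σ)
           (τ : Cycle p f (suc N)) (τ-lift : IsLift σ τ) where

    private
      x y : ℤ
      x = elem σ zero
      y = elem τ zero

      j : Fin (length σ)
      j = proj₁ (τ-lift zero)

      y≋ : y ≋ elem σ j [ N ]
      y≋ = proj₂ (τ-lift zero)

      y≋iter : y ≋ iter (toℕ j) x [ N ]
      y≋iter = ∣-difference-trans y (elem σ j) (iter (toℕ j) x) y≋
        (∣-difference-sym (iter (toℕ j) x) (elem σ j) (elem≋iter σ j))

    -- First move along the orbit of `x` to the class below `y`, then replace that point by `y`
    -- itself, congruent to it modulo `p ^ N`.
    Near-lift : ∀ {e d} → d ≤ e → d ≤ N → e ≤ d ℕ.+ N →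
      Near p (length σ) e d x → Near p (length σ) e d y
    Near-lift d≤e d≤N e≤d+N near =
      Near-resp p (length σ) (iter (toℕ j) x) y d≤N e≤d+N y≋iter
        (Near-iter p (length σ) (toℕ j) x d≤e near)

    Near-unlift : ∀ {e d} → d ≤ e → d ≤ N → e ≤ d ℕ.+ N →
      Near p (length σ) e d y → Near p (length σ) e d x
    Near-unlift d≤e d≤N e≤d+N near =
      Near-resp p (length σ) (iter l y) x d≤N e≤d+N (iter-to-start σ j y≋)
        (Near-iter p (length σ) l y d≤e near)
      where l = length σ ∸ toℕ j

    -- A longer `τ` would repeat an element, since `length σ` steps already fix `y` modulo
    -- `p ^ suc N`. A shorter `τ` would, after reduction modulo `p ^ N`, give `σ` too short a
    -- period.
    length-lift : length τ ≡ length σ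
    length-lift with ℕ.<-cmp (length τ) (length σ)
    ... | tri≈ _ eq _ = eq
    ... | tri> _ _ k<l = contradiction
      (proj₁ (Near-lift (s≤s z≤n) 1≤N ℕ.≤-refl σ-splits)) (no-shorter-period τ k<l)
    ... | tri< l<k _ _ = contradiction x-period (no-shorter-period σ l<k)
      where
      l = length τ
      m = length σ ∸ toℕ j
      x≋ : x ≋ iter m y [ N ]
      x≋ = iter-to-start σ j y≋
      x-period : iter l x ≋ x [ N ]
      x-period = ∣-difference-trans (iter l x) (iter l (iter m y)) x
        (iter-cong l x (iter m y) x≋)
        (∣-difference-trans (iter l (iter m y)) (iter m y) x
          (subst (_≋ iter m y [ N ]) (iter-comm m l y)
            (iter-cong m (iter l y) y (^-∣-weaken p (ℕ.n≤1+n N) (iter-length τ))))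
          (∣-difference-sym x (iter m y) x≋))

    CycleNear-lift : ∀ {e d} → d ≤ e → d ≤ N → e ≤ d ℕ.+ N → CycleNear e d σ → CycleNear e d τ
    CycleNear-lift {e} {d} d≤e d≤N e≤d+N near =
      subst (λ k → Near p k e d y) (sym length-lift) (Near-lift d≤e d≤N e≤d+N near)

    CycleNear-unlift : ∀ {e d} → d ≤ e → d ≤ N → e ≤ d ℕ.+ N → CycleNear e d τ → CycleNear e d σ
    CycleNear-unlift {e} {d} d≤e d≤N e≤d+N near =
      Near-unlift d≤e d≤N e≤d+N (subst (λ k → Near p k e d y) length-lift near)

  -- Descendants over several levels.

  module _ {N M d : ℕ} (τ : Cycle p f N) (1≤d : 1 ≤ d) (d≤N : d ≤ N) (N≤M : N ≤ M)
           (M≤d+N : M ≤ d ℕ.+ N) (near : CycleNear M d τ) where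

    private
      1≤ : ∀ i → 1 ≤ i ℕ.+ N
      1≤ i = ℕ.≤-trans 1≤d (ℕ.≤-trans d≤N (ℕ.m≤n+m N i))

      d≤ : ∀ i → d ≤ i ℕ.+ N
      d≤ i = ℕ.≤-trans d≤N (ℕ.m≤n+m N i)

      d+N≤ : ∀ i → d ℕ.+ N ≤ d ℕ.+ (i ℕ.+ N)
      d+N≤ i = ℕ.+-monoʳ-≤ d (ℕ.m≤n+m N i)

    -- As long as the level is below `M`, precision `M` says that the cycle splits, so one more lift
    -- is possible with `M` unchanged. The bounds `d ≤ N` and `M ≤ d + N` only loosen as the level
    -- rises.
    CycleNear-descendant : ∀ {i ρ} → i ℕ.+ N ≤ M → Descendant τ i ρ → CycleNear M d ρ
    CycleNear-descendant _ self = near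
    CycleNear-descendant {suc i} i+N<M (lift {ρ = ρ} {ρ′} desc ρ′-lift) =
      CycleNear-lift (1≤ i) ρ (Near-weaken p (length ρ) (elem ρ zero) i+N<M 1≤d ih) ρ′ ρ′-lift
        (ℕ.≤-trans d≤N N≤M) (d≤ i) (ℕ.≤-trans M≤d+N (d+N≤ i)) ih
      where ih = CycleNear-descendant (ℕ.<⇒≤ i+N<M) desc

    -- Precision `M` serves to make every intermediate cycle split; the exponent `e` brought down to
    -- `τ` may exceed `M`.
    CycleNear-ancestor : ∀ {e i ρ} → d ≤ e → e ≤ d ℕ.+ N → i ℕ.+ N ≤ M →
      Descendant τ i ρ → CycleNear e d ρ → CycleNear e d τ
    CycleNear-ancestor _ _ _ self ρ-near = ρ-near
    CycleNear-ancestor {i = suc i} d≤e e≤d+N i+N<M (lift {ρ = ρ} {ρ′} desc ρ′-lift) ρ′-near =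
      CycleNear-ancestor d≤e e≤d+N (ℕ.<⇒≤ i+N<M) desc
        (CycleNear-unlift (1≤ i) ρ
          (Near-weaken p (length ρ) (elem ρ zero) i+N<M 1≤d
            (CycleNear-descendant (ℕ.<⇒≤ i+N<M) desc))
          ρ′ ρ′-lift d≤e (d≤ i) (ℕ.≤-trans e≤d+N (d+N≤ i)) ρ′-near)

  -- Translation into splitting and growing.

  module _ .{{_ : NonZero p}} where

    module _ {N : ℕ} (σ : Cycle p f N) where

      private
        instance
          p^N≢0 : NonZero (p ^ N)
          p^N≢0 = ℕ.m^n≢0 p N

        x : ℤ
        x = elem σ zero

        p^1 : + (p ^ 1) ≡ + p
        p^1 = cong +_ (ℕ.*-identityʳ p)

      aₙ≡multiplier : aₙ σ ≡ multiplier (length σ) x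
      aₙ≡multiplier = eval-deriv-iterate (length σ) x

      displacement≡bₙ : iter (length σ) x - x ≡ bₙ σ * + (p ^ N)
      displacement≡bₙ =
        subst (λ z → z - x ≡ bₙ σ * + (p ^ N)) (eval-iterate (length σ) x)
          (/ℕ-exact (eval (return σ) x - x) (p ^ N)
            (subst (_≋ x [ N ]) (sym (eval-iterate (length σ) x)) (iter-length σ)))

      p^v∣bₙ⇒ : ∀ v → + (p ^ v) ∣ bₙ σ → iter (length σ) x ≋ x [ v ℕ.+ N ]
      p^v∣bₙ⇒ v d =
        subst₂ _∣_ (sym (pos-^-+ p v N)) (sym displacement≡bₙ) (*-monoˡ-∣ (+ (p ^ N)) d)

      p^v∣bₙ⇐ : ∀ v → iter (length σ) x ≋ x [ v ℕ.+ N ] → + (p ^ v) ∣ bₙ σ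
      p^v∣bₙ⇐ v d =
        *-cancelʳ-∣ (+ (p ^ N)) {{p^N≢0}} (subst₂ _∣_ (pos-^-+ p v N) displacement≡bₙ d)

      CycleNear⇐ : ∀ e d → + (p ^ e) ∣ bₙ σ → + (p ^ d) ∣ aₙ σ - 1ℤ →
        CycleNear (e ℕ.+ N) d σ
      CycleNear⇐ e d b a = p^v∣bₙ⇒ e b , subst (λ z → _ ∣ z - 1ℤ) aₙ≡multiplier a

      p∣bₙ⇐ : iter (length σ) x ≋ x [ suc N ] → bₙ σ ≡ 0ℤ [mod p ]
      p∣bₙ⇐ d = subst₂ _∣_ p^1 (sym (ℤ.+-identityʳ (bₙ σ))) (p^v∣bₙ⇐ 1 d)

      p∣bₙ⇒ : bₙ σ ≡ 0ℤ [mod p ] → iter (length σ) x ≋ x [ suc N ]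
      p∣bₙ⇒ d = p^v∣bₙ⇒ 1 (subst₂ _∣_ (sym p^1) (ℤ.+-identityʳ (bₙ σ)) d)

      p∣aₙ-1⇐ : ∀ {d} → 1 ≤ d → multiplier (length σ) x ≋ 1ℤ [ d ] → aₙ σ ≡ 1ℤ [mod p ]
      p∣aₙ-1⇐ 1≤d m = subst₂ (λ q z → q ∣ z - 1ℤ) p^1 (sym aₙ≡multiplier) (^-∣-weaken p 1≤d m)

      CycleNear⇒Splits : ∀ {e d} → suc N ≤ e → 1 ≤ d → CycleNear e d σ → Splits σ
      CycleNear⇒Splits N<e 1≤d (b , a) = p∣aₙ-1⇐ 1≤d a , p∣bₙ⇐ (^-∣-weaken p N<e b)

      Splits⇒CycleNear : Splits σ → CycleNear (suc N) 1 σ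
      Splits⇒CycleNear (a , b) =
        p∣bₙ⇒ b , subst₂ (λ q z → q ∣ z - 1ℤ) (sym p^1) aₙ≡multiplier a

      multiplier⇒Grows : ∀ {d} → 1 ≤ d → multiplier (length σ) x ≋ 1ℤ [ d ] →
        ¬ iter (length σ) x ≋ x [ suc N ] → Grows σ
      multiplier⇒Grows 1≤d a sharp = p∣aₙ-1⇐ 1≤d a , sharp ∘ p∣bₙ⇒

    -- Descendants inherit the exponent `s + N`, which exceeds their own level `i + N` for every
    -- `i < s`.
    splitsTimes : ∀ {N d s} (τ : Cycle p f N) → 1 ≤ d → s ≤ d → d ≤ N →
      CycleNear (s ℕ.+ N) d τ → SplitsTimes s τ
    splitsTimes {N} {d} {s} τ 1≤d s≤d d≤N near i i<s ρ desc =
      CycleNear⇒Splits ρ {s ℕ.+ N} (ℕ.+-monoˡ-≤ N i<s) 1≤d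
        (CycleNear-descendant τ 1≤d d≤N (ℕ.m≤n+m N s) (ℕ.+-monoˡ-≤ N s≤d) near
          (ℕ.+-monoˡ-≤ N (ℕ.<⇒≤ i<s)) desc)

    -- If a descendant at level `s + N` failed to grow, its displacement would reach exponent
    -- `suc s + N`, and this would descend to `τ` against sharpness. The descent needs
    -- `suc s + N ≤ d + N`, hence `s < d`.
    splitsTimesThenGrows : ∀ {N d s} (τ : Cycle p f N) → s < d → d ≤ N →
      CycleNear (s ℕ.+ N) d τ → ¬ CycleNear (suc s ℕ.+ N) d τ → SplitsTimesThenGrows s τ
    splitsTimesThenGrows {N} {d} {s} τ s<d d≤N near sharp =
      splitsTimes τ 1≤d (ℕ.<⇒≤ s<d) d≤N near , grows
      where
      1≤d : 1 ≤ d
      1≤d = ℕ.≤-trans (s≤s z≤n) s<d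
      grows : ∀ ρ → Descendant τ s ρ → Grows ρ
      grows ρ desc = multiplier⇒Grows ρ 1≤d (proj₂ ρ-near) λ ρ-fix →
        sharp (CycleNear-ancestor τ 1≤d d≤N (ℕ.m≤n+m N s) (ℕ.+-monoˡ-≤ N (ℕ.<⇒≤ s<d)) near
          (ℕ.≤-trans d≤N (ℕ.m≤n+m N (suc s))) (ℕ.+-monoˡ-≤ N s<d) ℕ.≤-refl desc
          (ρ-fix , proj₂ ρ-near))
        where
        ρ-near : CycleNear (s ℕ.+ N) d ρ
        ρ-near = CycleNear-descendant τ 1≤d d≤N (ℕ.m≤n+m N s) (ℕ.+-monoˡ-≤ N (ℕ.<⇒≤ s<d)) near
          ℕ.≤-refl desc

-- The exponent `m + n` counts `m` splits from level `n` but `m ∸ 1` from the level of a lift;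
-- `1 ≤ m` rules out truncation.
pred-+-suc : ∀ {m} n → 1 ≤ m → m ∸ 1 ℕ.+ suc n ≡ m ℕ.+ n
pred-+-suc {suc m} n _ = ℕ.+-suc m n

-- The exceptional lift and its tower.

module _ {p : ℕ} .{{_ : NonZero p}} {f : Poly} where

  open Iteration f

  private
    infix 4 _≋_[_]
    _≋_[_] : ℤ → ℤ → ℕ → Set
    x ≋ y [ N ] = x ≡ y [mod p ^ N ]

  -- In terms of a and b: A ≤ ord b and ord (a − 1) = A.
  Exceptional : ∀ {N} → ℕ → Cycle p f N → Set
  Exceptional {N} A σ = CycleNear (A ℕ.+ N) A σ × ¬ CycleNear (suc A) (suc A) σ

  module _ {N A : ℕ} (p-prime : Prime p) (1≤A : 1 ≤ A) (A<N : A < N)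
           (σ : Cycle p f N) (exceptional : Exceptional A σ) where

    private
      x : ℤ
      x = elem σ zero

      k : ℕ
      k = length σ

      1≤N : 1 ≤ N
      1≤N = ℕ.≤-trans 1≤A (ℕ.<⇒≤ A<N)

      σ-near : CycleNear (A ℕ.+ N) A σ
      σ-near = proj₁ exceptional

      σ-splits : CycleNear (suc N) 1 σ
      σ-splits = Near-weaken p k x (ℕ.+-monoˡ-≤ N 1≤A) 1≤A σ-near

      -- At a level above `A` the displacement half of `CycleNear (suc A) (suc A)` is automatic, so
      -- its failure concerns the multiplier. The paired form is the one that can be carried between
      -- a cycle and its lifts.
      sharp-multiplier : ∀ {M} (τ : Cycle p f M) → suc A ≤ M → ¬ CycleNear (suc A) (suc A) τ →
        ¬ multiplier (length τ) (elem τ zero) ≋ 1ℤ [ suc A ]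
      sharp-multiplier τ A<M sharp m = sharp (^-∣-weaken p A<M (iter-length τ) , m)

      refinement : ∃[ y ] y ≋ x [ N ] × iter k y ≋ y [ suc (A ℕ.+ N) ]
      refinement = refine p p-prime k x A<N σ-near (sharp-multiplier σ A<N (proj₂ exceptional))

      x′ : ℤ
      x′ = proj₁ refinement

      x′≋x : x′ ≋ x [ N ]
      x′≋x = proj₁ (proj₂ refinement)

      x′-fix : iter k x′ ≋ x′ [ suc (A ℕ.+ N) ]
      x′-fix = proj₂ (proj₂ refinement)

      iter-x′≋elem : ∀ i → iter (toℕ i) x′ ≋ elem σ i [ N ]
      iter-x′≋elem i = ∣-difference-trans (iter (toℕ i) x′) (iter (toℕ i) x) (elem σ i)
        (iter-cong (toℕ i) x′ x x′≋x) (elem≋iter σ i)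

    -- The orbit of the refined point `x′`: its elements are distinct because they reduce to those
    -- of `σ`, and it closes because `suc N ≤ suc (A + N)`.
    exceptionalLift : Cycle p f (suc N)
    exceptionalLift = record
      { length-1 = length-1 σ
      ; elem     = λ i → iter (toℕ i) x′
      ; distinct = λ {i} {j} eq → distinct σ
          (∣-difference-resp (iter (toℕ i) x′) (elem σ i) (elem σ j) (iter-x′≋elem i)
            (∣-difference-trans (iter (toℕ i) x′) (iter (toℕ j) x′) (elem σ j)
              (^-∣-weaken p (ℕ.n≤1+n N) eq) (iter-x′≋elem j)))
      ; step     = λ i → subst (λ m → eval f (iter m x′) ≋ iter (suc (toℕ i)) x′ [ suc N ])
          (sym (Fin.toℕ-inject₁ i)) (∣-difference-refl (iter (suc (toℕ i)) x′))
      ; close    = subst (λ m → eval f (iter m x′) ≋ x′ [ suc N ])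
          (sym (Fin.toℕ-fromℕ (length-1 σ)))
          (^-∣-weaken p (s≤s (ℕ.m≤n+m N A)) x′-fix)
      }

    exceptionalLift-isLift : IsLift σ exceptionalLift
    exceptionalLift-isLift i = i , iter-x′≋elem i

    private
      sharp-lift : ∀ τ → IsLift σ τ → ¬ CycleNear (suc A) (suc A) τ
      sharp-lift τ τ-lift =
        proj₂ exceptional ∘ CycleNear-unlift 1≤N σ σ-splits τ τ-lift ℕ.≤-refl A<N (ℕ.m≤m+n (suc A) N)

      near-lift : ∀ τ → IsLift σ τ → CycleNear (A ℕ.+ N) A τ
      near-lift τ τ-lift =
        CycleNear-lift 1≤N σ σ-splits τ τ-lift (ℕ.m≤m+n A N) (ℕ.<⇒≤ A<N) ℕ.≤-refl σ-near

      lift-near : CycleNear (suc (A ℕ.+ N)) A exceptionalLift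
      lift-near = x′-fix , proj₂ (near-lift exceptionalLift exceptionalLift-isLift)

    -- Refinement gains one power of `p` in the displacement, exactly the power demanded by the rise
    -- in level; this makes the construction repeatable.
    exceptionalLift-exceptional : Exceptional A exceptionalLift
    exceptionalLift-exceptional =
      subst (λ e → CycleNear e A exceptionalLift) (sym (ℕ.+-suc A N)) lift-near ,
      sharp-lift exceptionalLift exceptionalLift-isLift

    Exceptional⇒Splits : Splits σ
    Exceptional⇒Splits = CycleNear⇒Splits σ {suc N} ℕ.≤-refl ℕ.≤-refl σ-splits

    -- Move `x′` along its orbit to the class of `y` modulo `p ^ N`. Uniqueness of the refinement
    -- improves the congruence to `p ^ suc N`, and one common element identifies the cycles.
    exceptionalLift-unique : ∀ τ → IsLift σ τ → CycleNear (suc (A ℕ.+ N)) A τ →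
      τ ≈ exceptionalLift
    exceptionalLift-unique τ τ-lift near =
      common-elem⇒≈ τ exceptionalLift j
        (∣-difference-sym (iter (toℕ j) x′) y
          (refine-unique p p-prime (length τ) y (iter (toℕ j) x′) A<N y′≋y y′-fix near
            (sharp-multiplier τ (ℕ.m≤n⇒m≤1+n A<N) (sharp-lift τ τ-lift))))
      where
      y = elem τ zero
      j = proj₁ (τ-lift zero)
      y′≋y : iter (toℕ j) x′ ≋ y [ N ]
      y′≋y = ∣-difference-trans (iter (toℕ j) x′) (elem σ j) y (iter-x′≋elem j)
        (∣-difference-sym y (elem σ j) (proj₂ (τ-lift zero)))
      y′-fix : iter (length τ) (iter (toℕ j) x′) ≋ iter (toℕ j) x′ [ suc (A ℕ.+ N) ]
      y′-fix = subst (λ l → iter l (iter (toℕ j) x′) ≋ iter (toℕ j) x′ [ suc (A ℕ.+ N) ])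
        (sym (length-lift 1≤N σ σ-splits τ τ-lift))
        (proj₁ (Near-iter p k (toℕ j) x′ (ℕ.m≤n⇒m≤1+n (ℕ.m≤m+n A N)) lift-near))

    -- Every lift has exponent `A + N`, that is, `A ∸ 1` above its own level; one power more would
    -- make it the exceptional lift.
    non-exceptional-grows : ∀ τ → IsLift σ τ → τ ≉ exceptionalLift →
      SplitsTimesThenGrows (A ∸ 1) τ
    non-exceptional-grows τ τ-lift τ≉ =
      splitsTimesThenGrows τ (ℕ.≤-reflexive (ℕ.m+[n∸m]≡n 1≤A)) (ℕ.m≤n⇒m≤1+n (ℕ.<⇒≤ A<N))
        (subst (λ e → CycleNear e A τ) (sym level) (near-lift τ τ-lift))
        (τ≉ ∘ exceptionalLift-unique τ τ-lift ∘ subst (λ e → CycleNear (suc e) A τ) level)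
      where
      level : A ∸ 1 ℕ.+ suc N ≡ A ℕ.+ N
      level = pred-+-suc N 1≤A

  module _ {N A : ℕ} (p-prime : Prime p) (1≤A : 1 ≤ A) (A<N : A < N)
           (σ : Cycle p f N) (exceptional : Exceptional A σ) where

    private
      A<i+N : ∀ i → A < i ℕ.+ N
      A<i+N i = ℕ.≤-trans A<N (ℕ.m≤n+m N i)

      -- The invariant travels with the cycle because each refinement depends on it.
      tower : ∀ i → Σ[ τ ∈ Cycle p f (i ℕ.+ N) ] Exceptional A τ
      tower zero    = σ , exceptional
      tower (suc i) with tower i
      ... | τ , τ-exceptional =
        exceptionalLift p-prime 1≤A (A<i+N i) τ τ-exceptional ,
        exceptionalLift-exceptional p-prime 1≤A (A<i+N i) τ τ-exceptional

      σs : ∀ i → Cycle p f (i ℕ.+ N)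
      σs i = proj₁ (tower i)

    exceptional-tower :
      Σ[ σs ∈ (∀ i → Cycle p f (i ℕ.+ N)) ]
        ( σs 0 ≡ σ
        × (∀ i → Splits (σs i))
        × (∀ i → IsLift (σs i) (σs (suc i)))
        × (∀ i τ → IsLift (σs i) τ → τ ≉ σs (suc i) → SplitsTimesThenGrows (A ∸ 1) τ))
    exceptional-tower =
      σs , refl ,
      (λ i → Exceptional⇒Splits p-prime 1≤A (A<i+N i) (σs i) (proj₂ (tower i))) ,
      (λ i → exceptionalLift-isLift p-prime 1≤A (A<i+N i) (σs i) (proj₂ (tower i))) ,
      (λ i → non-exceptional-grows p-prime 1≤A (A<i+N i) (σs i) (proj₂ (tower i)))

-- Valuations and the three cases.

Ord-≤⁺ : ∀ {p z m v} → Ord p z v → [ m ] ≤⁺ v → + (p ^ m) ∣ z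
Ord-≤⁺ (infinite refl)          _       = divides 0ℤ refl
Ord-≤⁺ {p} (finite p^v∣z _) ≤-[ m≤v ] = ^-∣-weaken p m≤v p^v∣z

Ord-sharp : ∀ {p z v} → Ord p z [ v ] → ¬ + (p ^ suc v) ∣ z
Ord-sharp (finite _ p^1+v∤z) = p^1+v∤z

Ord-positive : ∀ {p z v} → Ord p z [ v ] → + (p ^ 1) ∣ z → 1 ≤ v
Ord-positive {v = zero}  (finite _ p^1∤z) p^1∣z = contradiction p^1∣z p^1∤z
Ord-positive {v = suc _} _                _     = s≤s z≤n

<⁺⇒suc≤⁺ : ∀ {m v} → [ m ] <⁺ v → [ suc m ] ≤⁺ v
<⁺⇒suc≤⁺ <-[ m<v ] = ≤-[ m<v ]
<⁺⇒suc≤⁺ (<-⊤⁺ m)  = ≤-⊤⁺ [ suc m ]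

mainTheorem7 : ∀ (p : ℕ) .{{_ : NonZero p}} → Prime p → 2 ∤ p →
    ∀ (f : Poly) (n : ℕ) → 1 ≤ n →
    ∀ (σ : Cycle p f n) → Splits σ →
    ∀ (A B : ℕ ⁺) → Ord p (aₙ σ - 1ℤ) A → Ord p (bₙ σ) B →
    (B <⁺ A → B <⁺ [ n ] → ∀ β → B ≡ [ β ] →
    ∀ τ → IsLift σ τ → SplitsTimesThenGrows (β ∸ 1) τ)
    × (A ≤⁺ B → A <⁺ [ n ] → ∀ α → A ≡ [ α ] →
    Σ[ σs ∈ (∀ i → Cycle p f (i ℕ.+ n)) ]
    ( σs 0 ≡ σ
    × (∀ i → Splits (σs i))
    × (∀ i → IsLift (σs i) (σs (suc i)))
    × (∀ i τ → IsLift (σs i) τ → τ ≉ σs (suc i) →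
    SplitsTimesThenGrows (α ∸ 1) τ)))
    × ([ n ] ≤⁺ A → [ n ] ≤⁺ B →
    ∀ τ → IsLift σ τ → SplitsTimes (n ∸ 1) τ)
mainTheorem7 p p-prime _ f n 1≤n σ σ-splits A B ordA ordB = part₁ , part₂ , part₃
  where
  near-split : CycleNear (suc n) 1 σ
  near-split = Splits⇒CycleNear σ σ-splits

  part₁ : B <⁺ A → B <⁺ [ n ] → ∀ β → B ≡ [ β ] →
    ∀ τ → IsLift σ τ → SplitsTimesThenGrows (β ∸ 1) τ
  part₁ β<A <-[ β<n ] β refl τ τ-lift =
    -- The multiplier precision is `suc β`, available since `B` is below `A`. It lets exponent
    -- `suc (β + n)` descend from `τ` to `σ`, where it contradicts the valuation of `bₙ σ`.
    splitsTimesThenGrows τ (s≤s (ℕ.m∸n≤m β 1)) (ℕ.m≤n⇒m≤1+n β<n)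
      (subst (λ e → CycleNear e (suc β) τ) (sym level)
        (CycleNear-lift 1≤n σ near-split τ τ-lift
          (ℕ.≤-trans β<n (ℕ.m≤n+m n β)) β<n (ℕ.n≤1+n (β ℕ.+ n))
          (CycleNear⇐ σ β (suc β) (Ord-≤⁺ ordB ≤-[ ℕ.≤-refl ]) (Ord-≤⁺ ordA (<⁺⇒suc≤⁺ β<A)))))
      (λ near → Ord-sharp ordB (p^v∣bₙ⇐ σ (suc β) (proj₁
        (CycleNear-unlift 1≤n σ near-split τ τ-lift
          (ℕ.m≤m+n (suc β) n) β<n ℕ.≤-refl
          (subst (λ e → CycleNear (suc e) (suc β) τ) level near)))))
    where
    level : β ∸ 1 ℕ.+ suc n ≡ β ℕ.+ n
    level = pred-+-suc n (Ord-positive ordB (p^v∣bₙ⇐ σ 1 (proj₁ near-split)))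

  part₂ : A ≤⁺ B → A <⁺ [ n ] → ∀ α → A ≡ [ α ] →
    Σ[ σs ∈ (∀ i → Cycle p f (i ℕ.+ n)) ]
    ( σs 0 ≡ σ
    × (∀ i → Splits (σs i))
    × (∀ i → IsLift (σs i) (σs (suc i)))
    × (∀ i τ → IsLift (σs i) τ → τ ≉ σs (suc i) →
    SplitsTimesThenGrows (α ∸ 1) τ))
  part₂ α≤B <-[ α<n ] α refl =
    exceptional-tower p-prime
      (Ord-positive ordA (subst (λ z → _ ∣ z - 1ℤ) (sym (aₙ≡multiplier σ)) (proj₂ near-split)))
      α<n σ
      ( CycleNear⇐ σ α α (Ord-≤⁺ ordB α≤B) (Ord-≤⁺ ordA ≤-[ ℕ.≤-refl ])
      -- Refuting the multiplier half of the pair suffices.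
      , Ord-sharp ordA ∘ subst (λ z → _ ∣ z - 1ℤ) (sym (aₙ≡multiplier σ)) ∘ proj₂)

  part₃ : [ n ] ≤⁺ A → [ n ] ≤⁺ B → ∀ τ → IsLift σ τ → SplitsTimes (n ∸ 1) τ
  part₃ n≤A n≤B τ τ-lift =
    -- With `d = n`, the exponent `n + n` is the largest that Taylor precision at level `n` carries
    -- to a lift; it lies `n ∸ 1` above level `suc n`.
    splitsTimes τ 1≤n (ℕ.m∸n≤m n 1) (ℕ.n≤1+n n)
      (subst (λ e → CycleNear e n τ) (sym (pred-+-suc n 1≤n))
        (CycleNear-lift 1≤n σ near-split τ τ-lift (ℕ.m≤m+n n n) ℕ.≤-refl ℕ.≤-refl
          (CycleNear⇐ σ n n (Ord-≤⁺ ordB n≤B) (Ord-≤⁺ ordA n≤A))))
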